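{- For every parity game $(V,\to,\Omega,\mathcal P)$, governed bisimilarity is an equivalence relation on $V$.
   Context: A parity game is a tuple $(V,\to,\Omega,\mathcal P)$ where $V$ is a finite set of vertices, $\to\subseteq V\times V$ is total (every vertex has at least one successor), $\Omega:V\to\mathbb N$ is a priority function, and $\mathcal P:V\to\{\Diamond,\Box\}$ assigns each vertex to player even ($\Diamond$) or odd ($\Box$). Write $v^\bullet=\{w\mid v\to w\}$. A symmetric relation $R\subseteq V\times V$ is a governed bisimulation iff $v\,R\,w$ implies: (1) $\Omega(v)=\Omega(w)$; (2) if $\mathcal P(v)\neq\mathcal P(w)$, then $v'\,R\,w'$ for all $v'\in v^\bullet$ and $w'\in w^\bullet$; (3) for all $v'\in v^\bullet$ there is some $w'\in w^\bullet$ with $v'\,R\,w'$. Vertices $v,w$ are governed bisimilar iff some governed bisimulation $R$ has $v\,R\,w$. -}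

module Defs where

open import Data.Fin.Base using (Fin)
open import Data.Nat.Base using (ℕ)
open import Data.Product.Base using (∃-syntax; _×_)
open import Function.Bundles using (_↔_)
open import Level using (0ℓ; suc)
open import Relation.Binary.Core using (Rel)
open import Relation.Binary.Definitions using (Symmetric)
open import Relation.Binary.PropositionalEquality.Core using (_≡_; _≢_)
open import Relation.Unary using (Pred; _∈_; Satisfiable)

data Player : Set where
  ◇ : Player  -- even
  □ : Player  -- odd

record ParityGame : Set₁ where
  infix 4 _⟶_
  field
    V      : Set
    finite : ∃[ n ] (V ↔ Fin n)
    _⟶_    : Rel V 0ℓ
    Ω      : V → ℕ
    𝒫      : V → Player

  infix 8 _•
  _• : V → Pred V 0ℓ
  (v •) w = v ⟶ w

  field
    total : ∀ v → Satisfiable (v •)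

module _ (G : ParityGame) where
  open ParityGame G

  record IsGovernedBisimulation (R : Rel V 0ℓ) : Set where
    field
      symmetric : Symmetric R
      priority  : ∀ {v w} → R v w → Ω v ≡ Ω w
      governed  : ∀ {v w} → R v w → 𝒫 v ≢ 𝒫 w →
                  ∀ {v′ w′} → v′ ∈ v • → w′ ∈ w • → R v′ w′
      transfer  : ∀ {v w} → R v w →
                  ∀ {v′} → v′ ∈ v • → ∃[ w′ ] (w′ ∈ w • × R v′ w′)

  GovernedBisimilar : Rel V (suc 0ℓ)
  GovernedBisimilar v w = ∃[ R ] (IsGovernedBisimulation R × R v w)

{-# OPTIONS --safe #-}
module Submission where

open import Defs
open import Relation.Binary.Structures using (IsEquivalence)

open import Data.Product.Base using (_,_; _×_; ∃-syntax)
open import Data.Sum.Base using (inj₁; inj₂; [_,_])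
open import Function.Base using (_∘_)
open import Level using (0ℓ)
open import Relation.Binary.Construct.Closure.ReflexiveTransitive
  using (Star; ε; _◅_; reverse)
open import Relation.Binary.Construct.Union as Union using (_∪_)
open import Relation.Binary.Core using (Rel)
open import Relation.Binary.Definitions using (DecidableEquality)
open import Relation.Binary.PropositionalEquality.Core
  using (_≡_; _≢_; refl; sym; trans)
open import Relation.Nullary using (yes; no; contradiction)
open import Relation.Unary using (_∈_)

-- Transitivity: if R and S are governed bisimulations, so is the
-- reflexive-transitive closure of R ∪ S.  A chain whose endpoints have
-- different owners contains a step a R b (or a S b) whose endpoints do, and
-- that step relates every successor of a to every successor of b.  Given
-- successors of the two endpoints of the chain, transfer one forwards to a
-- successor of a and the other backwards to a successor of b.

_≟_ : DecidableEquality Player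
◇ ≟ ◇ = yes refl
◇ ≟ □ = no λ ()
□ ≟ ◇ = no λ ()
□ ≟ □ = yes refl

module _ (G : ParityGame) where
  open ParityGame G

  ≡-isGovernedBisimulation : IsGovernedBisimulation G _≡_
  ≡-isGovernedBisimulation = record
    { symmetric = sym
    ; priority  = λ { refl → refl }
    ; governed  = λ { refl 𝒫v≢𝒫v → contradiction refl 𝒫v≢𝒫v }
    ; transfer  = λ { refl {v′} v′∈v• → v′ , v′∈v• , refl }
    }

  -- Each condition has a single related pair as its premise, and its conclusion survives enlarging
  -- the relation.
  ∪-isGovernedBisimulation : ∀ {R S} → IsGovernedBisimulation G R →
    IsGovernedBisimulation G S → IsGovernedBisimulation G (R ∪ S)
  ∪-isGovernedBisimulation {R} {S} isR isS = record
    { symmetric = Union.symmetric {L = R} {R = S} R.symmetric S.symmetric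
    ; priority  = [ R.priority , S.priority ]
    ; governed  = λ where
        (inj₁ r) 𝒫≢ v′∈ w′∈ → inj₁ (R.governed r 𝒫≢ v′∈ w′∈)
        (inj₂ s) 𝒫≢ v′∈ w′∈ → inj₂ (S.governed s 𝒫≢ v′∈ w′∈)
    ; transfer  = λ where
        (inj₁ r) v′∈ → let w′ , w′∈ , r′ = R.transfer r v′∈ in w′ , w′∈ , inj₁ r′
        (inj₂ s) v′∈ → let w′ , w′∈ , s′ = S.transfer s v′∈ in w′ , w′∈ , inj₂ s′
    }
    where
    module R = IsGovernedBisimulation isR
    module S = IsGovernedBisimulation isS

  module _ {R : Rel V 0ℓ} (isR : IsGovernedBisimulation G R) where
    open IsGovernedBisimulation isR

    Star-priority : ∀ {v w} → Star R v w → Ω v ≡ Ω w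
    Star-priority ε        = refl
    Star-priority (r ◅ rs) = trans (priority r) (Star-priority rs)

    Star-transfer : ∀ {v w} → Star R v w →
      ∀ {v′} → v′ ∈ v • → ∃[ w′ ] (w′ ∈ w • × Star R v′ w′)
    Star-transfer ε        v′∈ = _ , v′∈ , ε
    Star-transfer (r ◅ rs) v′∈ =
      let u′ , u′∈ , r′  = transfer r v′∈
          w′ , w′∈ , rs′ = Star-transfer rs u′∈
      in  w′ , w′∈ , r′ ◅ rs′

    Star-governed : ∀ {v w} → Star R v w → 𝒫 v ≢ 𝒫 w →
      ∀ {v′ w′} → v′ ∈ v • → w′ ∈ w • → Star R v′ w′
    Star-governed ε 𝒫v≢𝒫v _ _ = contradiction refl 𝒫v≢𝒫v
    Star-governed {v} (_◅_ {j = u} r rs) 𝒫v≢𝒫w v′∈ w′∈ with 𝒫 v ≟ 𝒫 u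
    ... | yes 𝒫v≡𝒫u =
      let u′ , u′∈ , r′ = transfer r v′∈
      -- The owner is the same at `v` and `u`, so it still differs between `u` and `w`, and the
      -- recursion starts from `u′`.
      in  r′ ◅ Star-governed rs (𝒫v≢𝒫w ∘ trans 𝒫v≡𝒫u) u′∈ w′∈
    ... | no 𝒫v≢𝒫u =
      -- Running `rs` backwards takes `w′` to some `u′`, about which nothing more is known;
      -- `governed` links `v′` to any successor of `u`.
      let u′ , u′∈ , rs′ = Star-transfer (reverse symmetric rs) w′∈
      in  governed r 𝒫v≢𝒫u v′∈ u′∈ ◅ reverse symmetric rs′

    Star-isGovernedBisimulation : IsGovernedBisimulation G (Star R)
    Star-isGovernedBisimulation = record
      { symmetric = reverse symmetric
      ; priority  = Star-priority
      ; governed  = Star-governed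
      ; transfer  = Star-transfer
      }

theorem5 : (G : ParityGame) → IsEquivalence (GovernedBisimilar G)
theorem5 G = record
  { refl  = _≡_ , ≡-isGovernedBisimulation G , refl
  ; sym   = λ (R , isR , r) → R , isR , IsGovernedBisimulation.symmetric isR r
  ; trans = λ (R , isR , r) (S , isS , s) →
      -- The composite of `R` and `S` need not be symmetric; this closure is, and it contains the
      -- composite as chains of length two.
      Star (R ∪ S) ,
      Star-isGovernedBisimulation G (∪-isGovernedBisimulation G isR isS) ,
      inj₁ r ◅ inj₂ s ◅ ε
  }
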